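{- Let $\mathsf{CS}$ be a constant specification for $\mathsf{Base}$. For any formula $A\in\mathcal{L}_{\mathsf J}$: if $\vDash_{\mathsf b}A$ (i.e. $A$ is true at every world of every basic model) then $\vdash_{\mathsf{JIK}_{\mathsf{CS}}}A$.
   Context: **Justification language.** Fix countable sets $\mathsf{Prop}$ (propositional variables), $\mathsf{PrfConst}$ (proof constants), $\mathsf{PrfVar}$ (proof variables), $\mathsf{SatVar}$ (satisfier variables). Proof terms $t\in\mathsf{PrfTm}$ and satisfier terms $m\in\mathsf{SatTm}$ are defined by mutual induction: $t ::= c\in\mathsf{PrfConst}\mid x\in\mathsf{PrfVar}\mid t\cdot t\mid t+t\mid {!t}\mid m\triangleright t$ and $m ::= a\in\mathsf{SatVar}\mid m\sqcup m\mid t\star m$. The justification language $\mathcal{L}_{\mathsf J}$ is $A ::= p\in\mathsf{Prop}\mid\bot\mid A\wedge A\mid A\vee A\mid A\to A\mid [t]A\mid\langle m\rangle A$. **The logic $\mathsf{JIK}_{\mathsf{CS}}$.** Let $\mathsf{Int}$ be a finite set of axiom (schemes) for intuitionistic propositional logic (complete with modus ponens). The axiom set $\mathsf{Base}$ is $\mathsf{Int}$ (over $\mathcal{L}_{\mathsf J}$) together with: $[s](A\to B)\to([t]A\to[s\cdot t]B)$; $[s](A\to B)\to(\langle m\rangle A\to\langle s\star m\rangle B)$; $\langle m\rangle(A\vee B)\to(\langle m\rangle A\vee\langle m\rangle B)$; $(\langle m\rangle A\to[t]B)\to[m\triangleright t](A\to B)$; $\langle m\rangle\bot\to\bot$; $[s]A\to[s+t]A$;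 $[t]A\to[s+t]A$; $\langle m\rangle A\to\langle m\sqcup n\rangle A$; $\langle n\rangle A\to\langle m\sqcup n\rangle A$. A constant specification $\mathsf{CS}$ is any set of formulas $[c]A$ with $c\in\mathsf{PrfConst}$ and $A$ an axiom instance of $\mathsf{Base}$. For finite $\Gamma$, $\Gamma\vdash_{\mathsf{JIK}_{\mathsf{CS}}}A$ means $\Gamma\vdash A$ is derivable with: ($\mathsf{ax}$) $\Gamma\vdash A$ for $A$ an axiom instance of $\mathsf{Base}$; ($\mathsf{id}$) $\Gamma\vdash A$ for $A\in\Gamma$; ($\mathsf{mp}$) from $\Gamma\vdash A$ and $\Gamma\vdash A\to B$ infer $\Gamma\vdash B$; ($\mathsf{can}$) $\Gamma\vdash[!^k c]\cdots[!c][c]A$ for any $[c]A\in\mathsf{CS}$ and $k\ge 0$, where $!^k c$ is $k$-fold application of $!$ to $c$. $\vdash_{\mathsf{JIK}_{\mathsf{CS}}}A$ means $\emptyset\vdash_{\mathsf{JIK}_{\mathsf{CS}}}A$. **Basic models.** For sets of formulas $X,Y$ let $X\cdot Y:=\{B\mid A\to B\in X\text{ and }A\in Y\text{ for some }A\}$. A basic (intuitionistic modular) model (for $\mathsf{CS}$) is a tuple $\mathcal B=(W,\le,*)$ with $W$ a non-empty set, $\le$ a preorder on $W$, and $*$ assigning to each $p\in\mathsf{Prop}$ and $w\in W$ a value $p^*_w\in\{0,1\}$ and to each proof or satisfier term $s$ and $w\in W$ a set of formulas $s^*_w\subseteq\mathcal{L}_{\mathsf J}$, such that for all $w\in W$,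 proof terms $s,t$, satisfier terms $m,n$ and formulas $A,B$: (M1) if $w\le v$ and $p^*_w=1$ then $p^*_v=1$; (M2) if $w\le v$ then $t^*_w\subseteq t^*_v$ and $m^*_w\subseteq m^*_v$; (1) $s^*_w\cdot t^*_w\subseteq(s\cdot t)^*_w$; (2) $s^*_w\cdot m^*_w\subseteq(s\star m)^*_w$; (3) $s^*_w\cup t^*_w\subseteq(s+t)^*_w$; (4) $m^*_w\cup n^*_w\subseteq(m\sqcup n)^*_w$; (5) $A\in t^*_w$ for any formula $[t]A$ that is a conclusion of $\mathsf{can}$; (6) if $A\vee B\in m^*_w$ then $A\in m^*_w$ or $B\in m^*_w$; (7) if for all $v\ge w$, $A\notin m^*_v$ or $B\in t^*_v$, then $A\to B\in(m\triangleright t)^*_w$; (8) $\bot\notin m^*_w$. **Truth.** $\mathcal B,w\Vdash p$ iff $p^*_w=1$; never $\mathcal B,w\Vdash\bot$; $\wedge,\vee$ are evaluated pointwise; $\mathcal B,w\Vdash A\to B$ iff for all $v\ge w$, $\mathcal B,v\Vdash A$ implies $\mathcal B,v\Vdash B$; $\mathcal B,w\Vdash[t]A$ iff $A\in t^*_w$; $\mathcal B,w\Vdash\langle m\rangle A$ iff $A\in m^*_w$. $\vDash_{\mathsf b}A$ means $\mathcal B,w\Vdash A$ for every basic model $\mathcal B$ and every $w\in W$. -}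

module Defs where

open import Data.Bool.Base using (Bool; true)
open import Data.Empty using (⊥)
open import Data.List.Base using (List; []; _∷_)
open import Data.List.Membership.Propositional using () renaming (_∈_ to _∈ˡ_)
open import Data.Nat.Base using (ℕ; zero; suc)
open import Data.Product.Base using (_×_; ∃-syntax)
open import Data.Sum.Base using (_⊎_)
open import Function.Bundles using (_↣_; _⇔_)
open import Level using (0ℓ)
open import Relation.Binary.Core using (Rel)
open import Relation.Binary.PropositionalEquality.Core using (_≡_)
open import Relation.Binary.Structures using (IsPreorder)
open import Relation.Unary using (Pred; _∈_; _∉_; _⊆_; _∪_)

-- Countability is an injection into ℕ, so finite (even empty) sets of
-- variables and constants are allowed.
record Signature : Set₁ where
  field
    PropVar  : Set
    PrfConst : Set
    PrfVar   : Set
    SatVar   : Set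
    propVar-countable  : PropVar ↣ ℕ
    prfConst-countable : PrfConst ↣ ℕ
    prfVar-countable   : PrfVar ↣ ℕ
    satVar-countable   : SatVar ↣ ℕ

module _ (𝓢 : Signature) where
  open Signature 𝓢

  infixl 8 _·_ _⋆_
  infixl 7 _+_ _⊔_
  infixr 8 _▷_
  infix  9 !_

  data PrfTm : Set
  data SatTm : Set

  data PrfTm where
    con : PrfConst → PrfTm
    var : PrfVar → PrfTm
    _·_ : PrfTm → PrfTm → PrfTm
    _+_ : PrfTm → PrfTm → PrfTm
    !_  : PrfTm → PrfTm
    _▷_ : SatTm → PrfTm → PrfTm

  data SatTm where
    var : SatVar → SatTm
    _⊔_ : SatTm → SatTm → SatTm
    _⋆_ : PrfTm → SatTm → SatTm

  infix  6 [_]_ ⟨_⟩_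
  infixr 5 _∧_
  infixr 4 _∨_
  infixr 3 _⇒_

  data Formula : Set where
    var   : PropVar → Formula
    bot   : Formula
    _∧_   : Formula → Formula → Formula
    _∨_   : Formula → Formula → Formula
    _⇒_   : Formula → Formula → Formula
    [_]_  : PrfTm → Formula → Formula
    ⟨_⟩_  : SatTm → Formula → Formula

infixr 5 _∧_
infixr 4 _∨_
infixr 3 _⇒_

-- Purely propositional formulas: axiom schemes are written as such
-- formulas, with the variables read as metavariables.
data Scheme : Set where
  var : ℕ → Scheme
  bot : Scheme
  _∧_ : Scheme → Scheme → Scheme
  _∨_ : Scheme → Scheme → Scheme
  _⇒_ : Scheme → Scheme → Scheme

substitute : (ℕ → Scheme) → Scheme → Scheme
substitute σ (var i) = σ i
substitute σ bot     = bot
substitute σ (φ ∧ ψ) = substitute σ φ ∧ substitute σ ψ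
substitute σ (φ ∨ ψ) = substitute σ φ ∨ substitute σ ψ
substitute σ (φ ⇒ ψ) = substitute σ φ ⇒ substitute σ ψ

-- Intuitionistic propositional logic, as natural deduction.
infix 2 _⊢IPL_
data _⊢IPL_ (Γ : List Scheme) : Scheme → Set where
  hyp : ∀ {φ} → φ ∈ˡ Γ → Γ ⊢IPL φ
  ⊥E  : ∀ {φ} → Γ ⊢IPL bot → Γ ⊢IPL φ
  ∧I  : ∀ {φ ψ} → Γ ⊢IPL φ → Γ ⊢IPL ψ → Γ ⊢IPL φ ∧ ψ
  ∧E₁ : ∀ {φ ψ} → Γ ⊢IPL φ ∧ ψ → Γ ⊢IPL φ
  ∧E₂ : ∀ {φ ψ} → Γ ⊢IPL φ ∧ ψ → Γ ⊢IPL ψ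
  ∨I₁ : ∀ {φ ψ} → Γ ⊢IPL φ → Γ ⊢IPL φ ∨ ψ
  ∨I₂ : ∀ {φ ψ} → Γ ⊢IPL ψ → Γ ⊢IPL φ ∨ ψ
  ∨E  : ∀ {φ ψ χ} → Γ ⊢IPL φ ∨ ψ → φ ∷ Γ ⊢IPL χ → ψ ∷ Γ ⊢IPL χ → Γ ⊢IPL χ
  ⇒I  : ∀ {φ ψ} → φ ∷ Γ ⊢IPL ψ → Γ ⊢IPL φ ⇒ ψ
  ⇒E  : ∀ {φ ψ} → Γ ⊢IPL φ ⇒ ψ → Γ ⊢IPL φ → Γ ⊢IPL ψ

data Hilbert (Ax : List Scheme) : Scheme → Set where
  ax : ∀ {φ} → φ ∈ˡ Ax → (σ : ℕ → Scheme) → Hilbert Ax (substitute σ φ)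
  mp : ∀ {φ ψ} → Hilbert Ax φ → Hilbert Ax (φ ⇒ ψ) → Hilbert Ax ψ

-- A finite set of schemes axiomatising intuitionistic propositional logic
-- with modus ponens as the only rule.
record IntAxioms : Set where
  field
    schemes  : List Scheme
    complete : ∀ φ → Hilbert schemes φ ⇔ ([] ⊢IPL φ)

module _ {𝓢 : Signature} where
  open Signature 𝓢

  instantiate : (ℕ → Formula 𝓢) → Scheme → Formula 𝓢
  instantiate σ (var i) = σ i
  instantiate σ bot     = bot
  instantiate σ (φ ∧ ψ) = instantiate σ φ ∧ instantiate σ ψ
  instantiate σ (φ ∨ ψ) = instantiate σ φ ∨ instantiate σ ψ
  instantiate σ (φ ⇒ ψ) = instantiate σ φ ⇒ instantiate σ ψ

  data Base (Int : IntAxioms) : Formula 𝓢 → Set where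
    int : ∀ {φ} → φ ∈ˡ IntAxioms.schemes Int → (σ : ℕ → Formula 𝓢) →
          Base Int (instantiate σ φ)
    k□  : ∀ s t A B →
          Base Int (([ s ] (A ⇒ B)) ⇒ (([ t ] A) ⇒ ([ s · t ] B)))
    k◇  : ∀ s m A B →
          Base Int (([ s ] (A ⇒ B)) ⇒ ((⟨ m ⟩ A) ⇒ (⟨ s ⋆ m ⟩ B)))
    ◇∨  : ∀ m A B →
          Base Int ((⟨ m ⟩ (A ∨ B)) ⇒ ((⟨ m ⟩ A) ∨ (⟨ m ⟩ B)))
    ◇□  : ∀ m t A B →
          Base Int (((⟨ m ⟩ A) ⇒ ([ t ] B)) ⇒ ([ m ▷ t ] (A ⇒ B)))
    ◇⊥  : ∀ m → Base Int ((⟨ m ⟩ bot) ⇒ bot)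
    +₁  : ∀ s t A → Base Int (([ s ] A) ⇒ ([ s + t ] A))
    +₂  : ∀ s t A → Base Int (([ t ] A) ⇒ ([ s + t ] A))
    ⊔₁  : ∀ m n A → Base Int ((⟨ m ⟩ A) ⇒ (⟨ m ⊔ n ⟩ A))
    ⊔₂  : ∀ m n A → Base Int ((⟨ n ⟩ A) ⇒ (⟨ m ⊔ n ⟩ A))

  bangs : ℕ → PrfConst → PrfTm 𝓢
  bangs zero    c = con c
  bangs (suc k) c = ! bangs k c

  -- bangBox k c A  is  [!ᵏ c] ⋯ [! c] [c] A.
  bangBox : ℕ → PrfConst → Formula 𝓢 → Formula 𝓢
  bangBox zero    c A = [ con c ] A
  bangBox (suc k) c A = [ bangs (suc k) c ] bangBox k c A

record ConstantSpecification (𝓢 : Signature) (Int : IntAxioms) : Set₁ where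
  open Signature 𝓢
  field
    formulas : Pred (Formula 𝓢) 0ℓ
    constant : ∀ {F} → F ∈ formulas →
               ∃[ c ] ∃[ A ] (F ≡ ([ con c ] A) × Base Int A)

module _ {𝓢 : Signature} {Int : IntAxioms} (CS : ConstantSpecification 𝓢 Int) where
  open Signature 𝓢
  open ConstantSpecification CS

  data CanConclusion : Formula 𝓢 → Set where
    can : ∀ k {c A} → ([ con c ] A) ∈ formulas → CanConclusion (bangBox k c A)

  data JIK (Γ : List (Formula 𝓢)) : Formula 𝓢 → Set where
    ax  : ∀ {A} → Base Int A → JIK Γ A
    id  : ∀ {A} → A ∈ˡ Γ → JIK Γ A
    mp  : ∀ {A B} → JIK Γ A → JIK Γ (A ⇒ B) → JIK Γ B
    can : ∀ {A} → CanConclusion A → JIK Γ A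

  ⊢JIK : Formula 𝓢 → Set
  ⊢JIK A = JIK [] A

infixl 8 _⊙_
_⊙_ : {𝓢 : Signature} → Pred (Formula 𝓢) 0ℓ → Pred (Formula 𝓢) 0ℓ → Pred (Formula 𝓢) 0ℓ
(X ⊙ Y) B = ∃[ A ] ((A ⇒ B) ∈ X × A ∈ Y)

-- The valuation * is split by sort: val for propositional variables,
-- prf for proof terms and sat for satisfier terms.
record BasicModel {𝓢 : Signature} {Int : IntAxioms}
                  (CS : ConstantSpecification 𝓢 Int) : Set₁ where
  open Signature 𝓢
  infix 4 _≤_
  field
    W          : Set
    inhabitant : W
    _≤_        : Rel W 0ℓ
    isPreorder : IsPreorder _≡_ _≤_

    val : PropVar → W → Bool
    prf : PrfTm 𝓢 → W → Pred (Formula 𝓢) 0ℓ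
    sat : SatTm 𝓢 → W → Pred (Formula 𝓢) 0ℓ

    val-mono : ∀ {w v} p → w ≤ v → val p w ≡ true → val p v ≡ true
    prf-mono : ∀ {w v} t → w ≤ v → prf t w ⊆ prf t v
    sat-mono : ∀ {w v} m → w ≤ v → sat m w ⊆ sat m v

    prf-·   : ∀ w s t → prf s w ⊙ prf t w ⊆ prf (s · t) w
    sat-⋆   : ∀ w s m → prf s w ⊙ sat m w ⊆ sat (s ⋆ m) w
    prf-+   : ∀ w s t → prf s w ∪ prf t w ⊆ prf (s + t) w
    sat-⊔   : ∀ w m n → sat m w ∪ sat n w ⊆ sat (m ⊔ n) w
    prf-can : ∀ w t A → CanConclusion CS ([ t ] A) → A ∈ prf t w
    sat-∨   : ∀ w m A B → (A ∨ B) ∈ sat m w → A ∈ sat m w ⊎ B ∈ sat m w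
    prf-▷   : ∀ w m t A B →
              (∀ v → w ≤ v → A ∉ sat m v ⊎ B ∈ prf t v) →
              (A ⇒ B) ∈ prf (m ▷ t) w
    sat-⊥   : ∀ w m → bot ∉ sat m w

module _ {𝓢 : Signature} {Int : IntAxioms} {CS : ConstantSpecification 𝓢 Int} where

  infix 2 _,_⊩_
  _,_⊩_ : (𝓑 : BasicModel CS) → BasicModel.W 𝓑 → Formula 𝓢 → Set
  𝓑 , w ⊩ var p     = BasicModel.val 𝓑 p w ≡ true
  𝓑 , w ⊩ bot       = ⊥
  𝓑 , w ⊩ A ∧ B     = (𝓑 , w ⊩ A) × (𝓑 , w ⊩ B)
  𝓑 , w ⊩ A ∨ B     = (𝓑 , w ⊩ A) ⊎ (𝓑 , w ⊩ B)
  𝓑 , w ⊩ A ⇒ B     = ∀ v → BasicModel._≤_ 𝓑 w v → 𝓑 , v ⊩ A → 𝓑 , v ⊩ B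
  𝓑 , w ⊩ ([ t ] A) = A ∈ BasicModel.prf 𝓑 t w
  𝓑 , w ⊩ (⟨ m ⟩ A) = A ∈ BasicModel.sat 𝓑 m w

module _ {𝓢 : Signature} {Int : IntAxioms} (CS : ConstantSpecification 𝓢 Int) where

  ⊨b : Formula 𝓢 → Set₁
  ⊨b A = (𝓑 : BasicModel CS) (w : BasicModel.W 𝓑) → 𝓑 , w ⊩ A

{-# OPTIONS --safe #-}
-- Canonical model argument.  The worlds are the prime theories ordered by
-- inclusion, and A belongs to the interpretation of a term exactly when the
-- corresponding modal formula belongs to the world, so that the modal cases of
-- the truth lemma are immediate.  A set not deriving C extends to a prime theory
-- omitting C: run through an enumeration of all formulas, adding each one unless
-- C would become derivable.  This lemma gives both the implication case of the
-- truth lemma and, via the axiom ◇□, model condition (7).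
module Submission where

open import Defs
open import Axiom.ExcludedMiddle using (ExcludedMiddle)
open import Data.Bool.Base using (Bool; true)
open import Data.List.Base using (List; []; _∷_; concat; map; cartesianProductWith)
open import Data.List.Membership.Propositional using () renaming (_∈_ to _∈ˡ_)
open import Data.List.Membership.Propositional.Properties
  using (∈-map⁺; ∈-concat⁺′; ∈-cartesianProductWith⁺)
open import Data.List.Relation.Unary.Any using (here; there)
open import Data.Nat.Base as ℕ using (ℕ; zero; suc; s≤s)
open import Data.Nat.Properties
  using (≤-refl; m⊔n<o⇒m<o; m⊔n<o⇒n<o; m≤m⊔n; m≤n⊔m; m≤n⇒m<n∨m≡n)
open import Data.Product.Base using (_×_; _,_; proj₁; ∃-syntax)
open import Data.Sum.Base as Sum using (_⊎_; inj₁; inj₂)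
open import Function.Base using (_∘_)
open import Function.Bundles using (_↣_; module Injection; module Equivalence)
open import Level using (0ℓ)
open import Relation.Binary.PropositionalEquality
  using (_≡_; refl; sym; trans; cong₂; subst; isEquivalence)
open import Relation.Nullary using (¬_; yes; no; does; contradiction)
open import Relation.Unary using (Pred; _∈_; _∉_; _⊆_; _∪_; ∅; ｛_｝)

-- Enumerating terms and formulas by finite lists.

module Enumeration (em : ExcludedMiddle 0ℓ) where

  module _ {V : Set} (countable : V ↣ ℕ) where
    open Injection countable using (to; injective)

    -- Whether a number is a code need not be decidable, so excluded middle is consulted at each
    -- one. Numbers that code nothing are skipped, which also covers an empty `V`.
    codesBelow : ℕ → List V
    codesBelow zero = []
    codesBelow (suc n) with em {∃[ v ] to v ≡ n}
    ... | yes (v , _) = v ∷ codesBelow n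
    ... | no _        = codesBelow n

    ∈-codesBelow : ∀ {v} n → to v ℕ.< n → v ∈ˡ codesBelow n
    ∈-codesBelow {v} (suc n) (s≤s to≤n)
      with em {∃[ u ] to u ≡ n} | m≤n⇒m<n∨m≡n to≤n
    ... | yes _        | inj₁ to<n = there (∈-codesBelow n to<n)
    ... | yes (_ , eq) | inj₂ to≡n = here (injective (trans to≡n (sym eq)))
    ... | no _         | inj₁ to<n = ∈-codesBelow n to<n
    ... | no ∄v        | inj₂ to≡n = contradiction (v , to≡n) ∄v

  module _ (𝓢 : Signature) where
    open Signature 𝓢

    proofTerms : ℕ → List (PrfTm 𝓢)
    satTerms   : ℕ → List (SatTm 𝓢)

    -- One list per constructor, under a name of its own so that the membership proofs can point to
    -- the class that contains a given term.
    proofTermClasses : ℕ → List (List (PrfTm 𝓢))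
    satTermClasses   : ℕ → List (List (SatTm 𝓢))

    proofTerms zero    = []
    proofTerms (suc n) = concat (proofTermClasses n)

    proofTermClasses n =
      -- The bound is `suc n` because atoms of height exactly `n` must appear here, whereas compound
      -- terms are built from parts of height below `n`.
      map con (codesBelow prfConst-countable (suc n))
      ∷ map var (codesBelow prfVar-countable (suc n))
      ∷ cartesianProductWith _·_ (proofTerms n) (proofTerms n)
      ∷ cartesianProductWith _+_ (proofTerms n) (proofTerms n)
      ∷ map !_ (proofTerms n)
      ∷ cartesianProductWith _▷_ (satTerms n) (proofTerms n)
      ∷ []

    satTerms zero    = []
    satTerms (suc n) = concat (satTermClasses n)

    satTermClasses n =
      map var (codesBelow satVar-countable (suc n))
      ∷ cartesianProductWith _⊔_ (satTerms n) (satTerms n)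
      ∷ cartesianProductWith _⋆_ (proofTerms n) (satTerms n)
      ∷ []

    formulas       : ℕ → List (Formula 𝓢)
    formulaClasses : ℕ → List (List (Formula 𝓢))

    formulas zero    = []
    formulas (suc n) = concat (formulaClasses n)

    formulaClasses n =
      map var (codesBelow propVar-countable (suc n))
      ∷ (bot ∷ [])
      ∷ cartesianProductWith _∧_ (formulas n) (formulas n)
      ∷ cartesianProductWith _∨_ (formulas n) (formulas n)
      ∷ cartesianProductWith _⇒_ (formulas n) (formulas n)
      ∷ cartesianProductWith [_]_ (proofTerms n) (formulas n)
      ∷ cartesianProductWith ⟨_⟩_ (satTerms n) (formulas n)
      ∷ []

    -- Atoms count with their code instead of zero. There may be infinitely many atoms, and this
    -- keeps the terms below any height finite in number.
    heightᵖ : PrfTm 𝓢 → ℕ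
    heightˢ : SatTm 𝓢 → ℕ

    heightᵖ (con c) = Injection.to prfConst-countable c
    heightᵖ (var x) = Injection.to prfVar-countable x
    heightᵖ (s · t) = suc (heightᵖ s ℕ.⊔ heightᵖ t)
    heightᵖ (s + t) = suc (heightᵖ s ℕ.⊔ heightᵖ t)
    heightᵖ (! t)   = suc (heightᵖ t)
    heightᵖ (m ▷ t) = suc (heightˢ m ℕ.⊔ heightᵖ t)

    heightˢ (var a) = Injection.to satVar-countable a
    heightˢ (m ⊔ n) = suc (heightˢ m ℕ.⊔ heightˢ n)
    heightˢ (t ⋆ m) = suc (heightᵖ t ℕ.⊔ heightˢ m)

    height : Formula 𝓢 → ℕ
    height (var p)   = Injection.to propVar-countable p
    height bot       = zero
    height (A ∧ B)   = suc (height A ℕ.⊔ height B)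
    height (A ∨ B)   = suc (height A ℕ.⊔ height B)
    height (A ⇒ B)   = suc (height A ℕ.⊔ height B)
    height ([ t ] A) = suc (heightᵖ t ℕ.⊔ height A)
    height (⟨ m ⟩ A) = suc (heightˢ m ℕ.⊔ height A)

    ∈-proofTerms : ∀ t n → heightᵖ t ℕ.< n → t ∈ˡ proofTerms n
    ∈-satTerms   : ∀ m n → heightˢ m ℕ.< n → m ∈ˡ satTerms n

    ∈-proofTerms (con c) (suc n) h =
      ∈-concat⁺′ {xss = proofTermClasses n}
        (∈-map⁺ con (∈-codesBelow prfConst-countable (suc n) h))
        (here refl)
    ∈-proofTerms (var x) (suc n) h =
      ∈-concat⁺′ {xss = proofTermClasses n}
        (∈-map⁺ var (∈-codesBelow prfVar-countable (suc n) h))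
        (there (here refl))
    ∈-proofTerms (s · t) (suc n) (s≤s h) =
      ∈-concat⁺′ {xss = proofTermClasses n}
        (∈-cartesianProductWith⁺ _·_
          (∈-proofTerms s n (m⊔n<o⇒m<o _ _ h))
          (∈-proofTerms t n (m⊔n<o⇒n<o _ _ h)))
        (there (there (here refl)))
    ∈-proofTerms (s + t) (suc n) (s≤s h) =
      ∈-concat⁺′ {xss = proofTermClasses n}
        (∈-cartesianProductWith⁺ _+_
          (∈-proofTerms s n (m⊔n<o⇒m<o _ _ h))
          (∈-proofTerms t n (m⊔n<o⇒n<o _ _ h)))
        (there (there (there (here refl))))
    ∈-proofTerms (! t) (suc n) (s≤s h) =
      ∈-concat⁺′ {xss = proofTermClasses n}
        (∈-map⁺ !_ (∈-proofTerms t n h))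
        (there (there (there (there (here refl)))))
    ∈-proofTerms (m ▷ t) (suc n) (s≤s h) =
      ∈-concat⁺′ {xss = proofTermClasses n}
        (∈-cartesianProductWith⁺ _▷_
          (∈-satTerms m n (m⊔n<o⇒m<o _ _ h))
          (∈-proofTerms t n (m⊔n<o⇒n<o _ _ h)))
        (there (there (there (there (there (here refl))))))

    ∈-satTerms (var a) (suc n) h =
      ∈-concat⁺′ {xss = satTermClasses n}
        (∈-map⁺ var (∈-codesBelow satVar-countable (suc n) h))
        (here refl)
    ∈-satTerms (l ⊔ m) (suc n) (s≤s h) =
      ∈-concat⁺′ {xss = satTermClasses n}
        (∈-cartesianProductWith⁺ _⊔_
          (∈-satTerms l n (m⊔n<o⇒m<o _ _ h))
          (∈-satTerms m n (m⊔n<o⇒n<o _ _ h)))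
        (there (here refl))
    ∈-satTerms (t ⋆ m) (suc n) (s≤s h) =
      ∈-concat⁺′ {xss = satTermClasses n}
        (∈-cartesianProductWith⁺ _⋆_
          (∈-proofTerms t n (m⊔n<o⇒m<o _ _ h))
          (∈-satTerms m n (m⊔n<o⇒n<o _ _ h)))
        (there (there (here refl)))

    ∈-formulas : ∀ A n → height A ℕ.< n → A ∈ˡ formulas n
    ∈-formulas (var p) (suc n) h =
      ∈-concat⁺′ {xss = formulaClasses n}
        (∈-map⁺ var (∈-codesBelow propVar-countable (suc n) h))
        (here refl)
    ∈-formulas bot (suc n) h =
      ∈-concat⁺′ {xss = formulaClasses n} (here refl) (there (here refl))
    ∈-formulas (A ∧ B) (suc n) (s≤s h) =
      ∈-concat⁺′ {xss = formulaClasses n}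
        (∈-cartesianProductWith⁺ _∧_
          (∈-formulas A n (m⊔n<o⇒m<o _ _ h))
          (∈-formulas B n (m⊔n<o⇒n<o _ _ h)))
        (there (there (here refl)))
    ∈-formulas (A ∨ B) (suc n) (s≤s h) =
      ∈-concat⁺′ {xss = formulaClasses n}
        (∈-cartesianProductWith⁺ _∨_
          (∈-formulas A n (m⊔n<o⇒m<o _ _ h))
          (∈-formulas B n (m⊔n<o⇒n<o _ _ h)))
        (there (there (there (here refl))))
    ∈-formulas (A ⇒ B) (suc n) (s≤s h) =
      ∈-concat⁺′ {xss = formulaClasses n}
        (∈-cartesianProductWith⁺ _⇒_
          (∈-formulas A n (m⊔n<o⇒m<o _ _ h))
          (∈-formulas B n (m⊔n<o⇒n<o _ _ h)))
        (there (there (there (there (here refl)))))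
    ∈-formulas ([ t ] A) (suc n) (s≤s h) =
      ∈-concat⁺′ {xss = formulaClasses n}
        (∈-cartesianProductWith⁺ [_]_
          (∈-proofTerms t n (m⊔n<o⇒m<o _ _ h))
          (∈-formulas A n (m⊔n<o⇒n<o _ _ h)))
        (there (there (there (there (there (here refl))))))
    ∈-formulas (⟨ m ⟩ A) (suc n) (s≤s h) =
      ∈-concat⁺′ {xss = formulaClasses n}
        (∈-cartesianProductWith⁺ ⟨_⟩_
          (∈-satTerms m n (m⊔n<o⇒m<o _ _ h))
          (∈-formulas A n (m⊔n<o⇒n<o _ _ h)))
        (there (there (there (there (there (there (here refl)))))))

-- Derivability from arbitrary sets and propositional reasoning.

module Derivability {𝓢 : Signature} {Int : IntAxioms} (CS : ConstantSpecification 𝓢 Int) where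

  instantiate-substitute : ∀ (σ : ℕ → Formula 𝓢) τ φ →
    instantiate σ (substitute τ φ) ≡ instantiate (instantiate σ ∘ τ) φ
  instantiate-substitute σ τ (var i) = refl
  instantiate-substitute σ τ bot     = refl
  instantiate-substitute σ τ (φ ∧ ψ) =
    cong₂ _∧_ (instantiate-substitute σ τ φ) (instantiate-substitute σ τ ψ)
  instantiate-substitute σ τ (φ ∨ ψ) =
    cong₂ _∨_ (instantiate-substitute σ τ φ) (instantiate-substitute σ τ ψ)
  instantiate-substitute σ τ (φ ⇒ ψ) =
    cong₂ _⇒_ (instantiate-substitute σ τ φ) (instantiate-substitute σ τ ψ)

  instantiate-Hilbert : ∀ (σ : ℕ → Formula 𝓢) {φ} →
    Hilbert (IntAxioms.schemes Int) φ → ⊢JIK CS (instantiate σ φ)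
  instantiate-Hilbert σ (ax {φ} φ∈ τ) =
    subst (⊢JIK CS) (sym (instantiate-substitute σ τ φ)) (ax (int φ∈ (instantiate σ ∘ τ)))
  instantiate-Hilbert σ (mp d e) = mp (instantiate-Hilbert σ d) (instantiate-Hilbert σ e)

  -- The schemes in `Int` are not known, only that they are complete. Every propositional law below
  -- is therefore proved by natural deduction and transferred through this lemma.
  instantiate-IPL : ∀ (σ : ℕ → Formula 𝓢) {φ} → [] ⊢IPL φ → ⊢JIK CS (instantiate σ φ)
  instantiate-IPL σ {φ} d =
    instantiate-Hilbert σ (Equivalence.from (IntAxioms.complete Int φ) d)

  -- Hypotheses may form an infinite set, as prime theories require. Theorems enter as leaves,
  -- leaving modus ponens as the only rule to treat in inductions.
  infix 2 _⊢_
  data _⊢_ (X : Pred (Formula 𝓢) 0ℓ) : Formula 𝓢 → Set where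
    theorem : ∀ {A} → ⊢JIK CS A → X ⊢ A
    hyp     : ∀ {A} → A ∈ X → X ⊢ A
    mp      : ∀ {A B} → X ⊢ A → X ⊢ A ⇒ B → X ⊢ B

  ∅⊢⇒⊢JIK : ∀ {A} → ∅ ⊢ A → ⊢JIK CS A
  ∅⊢⇒⊢JIK (theorem d) = d
  ∅⊢⇒⊢JIK (mp d e)    = mp (∅⊢⇒⊢JIK d) (∅⊢⇒⊢JIK e)

  weaken : ∀ {X Y A} → X ⊆ Y → X ⊢ A → Y ⊢ A
  weaken X⊆Y (theorem d) = theorem d
  weaken X⊆Y (hyp A∈X)   = hyp (X⊆Y A∈X)
  weaken X⊆Y (mp d e)    = mp (weaken X⊆Y d) (weaken X⊆Y e)

  module _ {X : Pred (Formula 𝓢) 0ℓ} where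

    axiom : ∀ {A} → Base Int A → X ⊢ A
    axiom = theorem ∘ ax

    assign : Formula 𝓢 → Formula 𝓢 → Formula 𝓢 → ℕ → Formula 𝓢
    assign A B C 0 = A
    assign A B C 1 = B
    assign A B C _ = C

    private
      v₀ v₁ v₂ : Scheme
      v₀ = var 0
      v₁ = var 1
      v₂ = var 2

      ipl : ∀ A B C {φ} → [] ⊢IPL φ → X ⊢ instantiate (assign A B C) φ
      ipl A B C = theorem ∘ instantiate-IPL (assign A B C)

    ⊢-refl : ∀ {A} → X ⊢ A ⇒ A
    ⊢-refl {A} = ipl A A A {v₀ ⇒ v₀} (⇒I (hyp (here refl)))

    ⊢-const : ∀ {A B} → X ⊢ B → X ⊢ A ⇒ B
    ⊢-const {A} {B} d =
      mp d (ipl A B A {v₁ ⇒ v₀ ⇒ v₁} (⇒I (⇒I (hyp (there (here refl))))))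

    ⊢-ap : ∀ {A B C} → X ⊢ A ⇒ B → X ⊢ A ⇒ B ⇒ C → X ⊢ A ⇒ C
    ⊢-ap {A} {B} {C} d e = mp e (mp d (ipl A B C
      {(v₀ ⇒ v₁) ⇒ (v₀ ⇒ v₁ ⇒ v₂) ⇒ v₀ ⇒ v₂}
      (⇒I (⇒I (⇒I (⇒E (⇒E (hyp (there (here refl))) (hyp (here refl)))
                      (⇒E (hyp (there (there (here refl)))) (hyp (here refl)))))))))

    ⊢-∧I : ∀ {A B} → X ⊢ A → X ⊢ B → X ⊢ A ∧ B
    ⊢-∧I {A} {B} d e = mp e (mp d (ipl A B A {v₀ ⇒ v₁ ⇒ v₀ ∧ v₁}
      (⇒I (⇒I (∧I (hyp (there (here refl))) (hyp (here refl)))))))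

    ⊢-∧E₁ : ∀ {A B} → X ⊢ A ∧ B → X ⊢ A
    ⊢-∧E₁ {A} {B} d = mp d (ipl A B A {v₀ ∧ v₁ ⇒ v₀} (⇒I (∧E₁ (hyp (here refl)))))

    ⊢-∧E₂ : ∀ {A B} → X ⊢ A ∧ B → X ⊢ B
    ⊢-∧E₂ {A} {B} d = mp d (ipl A B A {v₀ ∧ v₁ ⇒ v₁} (⇒I (∧E₂ (hyp (here refl)))))

    ⊢-∨I₁ : ∀ {A B} → X ⊢ A → X ⊢ A ∨ B
    ⊢-∨I₁ {A} {B} d = mp d (ipl A B A {v₀ ⇒ v₀ ∨ v₁} (⇒I (∨I₁ (hyp (here refl)))))

    ⊢-∨I₂ : ∀ {A B} → X ⊢ B → X ⊢ A ∨ B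
    ⊢-∨I₂ {A} {B} d = mp d (ipl A B A {v₁ ⇒ v₀ ∨ v₁} (⇒I (∨I₂ (hyp (here refl)))))

    ⊢-∨E : ∀ {A B C} → X ⊢ A ∨ B → X ⊢ A ⇒ C → X ⊢ B ⇒ C → X ⊢ C
    ⊢-∨E {A} {B} {C} c d e = mp e (mp d (mp c (ipl A B C
      {v₀ ∨ v₁ ⇒ (v₀ ⇒ v₂) ⇒ (v₁ ⇒ v₂) ⇒ v₂}
      (⇒I (⇒I (⇒I (∨E (hyp (there (there (here refl))))
        (⇒E (hyp (there (there (here refl)))) (hyp (here refl)))
        (⇒E (hyp (there (here refl))) (hyp (here refl))))))))))

    ⊢-⊥E : ∀ {A} → X ⊢ bot → X ⊢ A
    ⊢-⊥E {A} d = mp d (ipl A A A {bot ⇒ v₀} (⇒I (⊥E (hyp (here refl)))))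

    -- No rule introduces a box over a derived formula: the conclusions of `can` sit inside
    -- `theorem` leaves, so the usual propositional induction suffices.
    deduction : ∀ {F A} → X ∪ ｛ F ｝ ⊢ A → X ⊢ F ⇒ A
    deduction (theorem d)       = ⊢-const (theorem d)
    deduction (hyp (inj₁ A∈X))  = ⊢-const (hyp A∈X)
    deduction (hyp (inj₂ refl)) = ⊢-refl
    deduction (mp d e)          = ⊢-ap (deduction d) (deduction e)

-- Prime theories as worlds.

module Canonical (em : ExcludedMiddle 0ℓ) {𝓢 : Signature} {Int : IntAxioms}
                 (CS : ConstantSpecification 𝓢 Int) where
  open Enumeration em
  open Derivability CS

  Theory : (Formula 𝓢 → Bool) → Pred (Formula 𝓢) 0ℓ
  Theory χ A = χ A ≡ true

  -- Boolean characteristic functions keep the type of worlds in Set.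
  record World : Set where
    field
      χ          : Formula 𝓢 → Bool
      closed     : ∀ {A} → Theory χ ⊢ A → A ∈ Theory χ
      prime      : ∀ {A B} → (A ∨ B) ∈ Theory χ → A ∈ Theory χ ⊎ B ∈ Theory χ
      consistent : bot ∉ Theory χ

  open World

  ⟦_⟧ : World → Pred (Formula 𝓢) 0ℓ
  ⟦ w ⟧ = Theory (χ w)

  -- Extension to a prime theory omitting `C`.

  module Extension (C : Formula 𝓢) where

    -- The test for `F` is part of the membership condition, so the set is defined without a case
    -- split; excluded middle enters only in reasoning about it.
    adjoin : Pred (Formula 𝓢) 0ℓ → Formula 𝓢 → Pred (Formula 𝓢) 0ℓ
    adjoin X F A = A ∈ X ⊎ (F ≡ A × ¬ (X ∪ ｛ F ｝ ⊢ C))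

    adjoin-⊬ : ∀ {X} F → ¬ (X ⊢ C) → ¬ (adjoin X F ⊢ C)
    adjoin-⊬ {X} F X⊬C d with em {X ∪ ｛ F ｝ ⊢ C}
    ... | no F⊬C  = F⊬C (weaken (Sum.map₂ proj₁) d)
    ... | yes F⊢C = X⊬C (weaken
      (λ { (inj₁ A∈X) → A∈X ; (inj₂ (_ , F⊬C)) → contradiction F⊢C F⊬C }) d)

    adjoinAll : Pred (Formula 𝓢) 0ℓ → List (Formula 𝓢) → Pred (Formula 𝓢) 0ℓ
    adjoinAll X []       = X
    adjoinAll X (F ∷ Fs) = adjoinAll (adjoin X F) Fs

    ⊆-adjoinAll : ∀ {X} Fs → X ⊆ adjoinAll X Fs
    ⊆-adjoinAll []       A∈X = A∈X
    ⊆-adjoinAll (F ∷ Fs) A∈X = ⊆-adjoinAll Fs (inj₁ A∈X)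

    adjoinAll-⊬ : ∀ {X} Fs → ¬ (X ⊢ C) → ¬ (adjoinAll X Fs ⊢ C)
    adjoinAll-⊬ []       X⊬C = X⊬C
    adjoinAll-⊬ (F ∷ Fs) X⊬C = adjoinAll-⊬ Fs (adjoin-⊬ F X⊬C)

    -- When the turn of `A` comes it is either added, or rejected because it yields `C`. Both
    -- outcomes persist, since later sets only grow.
    adjoinAll-decides : ∀ {X A} Fs → A ∈ˡ Fs →
      A ∈ adjoinAll X Fs ⊎ (adjoinAll X Fs ∪ ｛ A ｝ ⊢ C)
    adjoinAll-decides (F ∷ Fs) (there A∈Fs) = adjoinAll-decides Fs A∈Fs
    adjoinAll-decides {X} (F ∷ Fs) (here refl) with em {X ∪ ｛ F ｝ ⊢ C}
    ... | yes F⊢C = inj₂ (weaken (Sum.map₁ (⊆-adjoinAll Fs ∘ inj₁)) F⊢C)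
    ... | no  F⊬C = inj₁ (⊆-adjoinAll Fs (inj₂ (refl , F⊬C)))

    module _ (X : Pred (Formula 𝓢) 0ℓ) (X⊬C : ¬ (X ⊢ C)) where

      stage : ℕ → Pred (Formula 𝓢) 0ℓ
      stage zero    = X
      stage (suc n) = adjoinAll (stage n) (formulas 𝓢 n)

      stage-mono : ∀ {m n} → m ℕ.≤ n → stage m ⊆ stage n
      stage-mono {n = zero}  ℕ.z≤n A∈ = A∈
      stage-mono {n = suc n} m≤1+n A∈ with m≤n⇒m<n∨m≡n m≤1+n
      ... | inj₁ (s≤s m≤n) = ⊆-adjoinAll (formulas 𝓢 n) (stage-mono m≤n A∈)
      ... | inj₂ refl      = A∈

      stage-⊬ : ∀ n → ¬ (stage n ⊢ C)
      stage-⊬ zero    = X⊬C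
      stage-⊬ (suc n) = adjoinAll-⊬ (formulas 𝓢 n) (stage-⊬ n)

      limit : Pred (Formula 𝓢) 0ℓ
      limit A = ∃[ n ] A ∈ stage n

      -- A derivation is a finite tree, and the stages form a chain, so the later of two stages
      -- serves both premises of modus ponens.
      limit-compact : ∀ {A} → limit ⊢ A → ∃[ n ] (stage n ⊢ A)
      limit-compact (theorem d)    = zero , theorem d
      limit-compact (hyp (n , A∈)) = n , hyp A∈
      limit-compact (mp d e) with limit-compact d | limit-compact e
      ... | m , d′ | n , e′ = m ℕ.⊔ n ,
        mp (weaken (stage-mono (m≤m⊔n m n)) d′) (weaken (stage-mono (m≤n⊔m m n)) e′)

      limit-⊬ : ¬ (limit ⊢ C)
      limit-⊬ d with limit-compact d
      ... | n , d′ = stage-⊬ n d′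

      -- Maximality relative to `C`: both deductive closure and primeness of the limit follow from
      -- this dichotomy together with `limit-⊬`.
      limit-maximal : ∀ A → A ∈ limit ⊎ (limit ⊢ A ⇒ C)
      limit-maximal A = Sum.map (suc n ,_)
        (deduction ∘ weaken (Sum.map₁ (suc n ,_)))
        (adjoinAll-decides (formulas 𝓢 n) (∈-formulas 𝓢 A n ≤-refl))
        -- This `n` strictly exceeds the height of `A`, so `A` is listed in `formulas 𝓢 n` and
        -- decided on the way to stage `suc n`.
        where n = suc (height 𝓢 A)

      limit-closed : ∀ {A} → limit ⊢ A → A ∈ limit
      limit-closed {A} d with limit-maximal A
      ... | inj₁ A∈  = A∈
      ... | inj₂ A⇒C = contradiction (mp d A⇒C) limit-⊬

      limit-prime : ∀ {A B} → (A ∨ B) ∈ limit → A ∈ limit ⊎ B ∈ limit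
      limit-prime {A} {B} A∨B∈ with limit-maximal A | limit-maximal B
      ... | inj₁ A∈  | _        = inj₁ A∈
      ... | inj₂ _   | inj₁ B∈  = inj₂ B∈
      ... | inj₂ A⇒C | inj₂ B⇒C = contradiction (⊢-∨E (hyp A∨B∈) A⇒C B⇒C) limit-⊬

      χ-limit : Formula 𝓢 → Bool
      χ-limit A = does (em {A ∈ limit})

      limit⊆χ : limit ⊆ Theory χ-limit
      limit⊆χ {A} A∈ with em {A ∈ limit}
      ... | yes _ = refl
      ... | no A∉ = contradiction A∈ A∉

      χ⊆limit : Theory χ-limit ⊆ limit
      χ⊆limit {A} eq with em {A ∈ limit}
      ... | yes A∈ = A∈

      world : World
      world = record
        { χ          = χ-limit
        ; closed     = limit⊆χ ∘ limit-closed ∘ weaken χ⊆limit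
        ; prime      = Sum.map limit⊆χ limit⊆χ ∘ limit-prime ∘ χ⊆limit
        ; consistent = limit-⊬ ∘ ⊢-⊥E ∘ hyp ∘ χ⊆limit
        }

      ⊆-world : X ⊆ ⟦ world ⟧
      ⊆-world A∈X = limit⊆χ (zero , A∈X)

      ∉-world : C ∉ ⟦ world ⟧
      ∉-world = limit-⊬ ∘ hyp ∘ χ⊆limit

  lindenbaum : ∀ {X C} → ¬ (X ⊢ C) → ∃[ w ] (X ⊆ ⟦ w ⟧ × C ∉ ⟦ w ⟧)
  lindenbaum {X} {C} X⊬C = world X X⊬C , ⊆-world X X⊬C , ∉-world X X⊬C
    where open Extension C

  -- The canonical model.

  infix 4 _≼_
  _≼_ : World → World → Set
  w ≼ v = ∀ {A} → A ∈ ⟦ w ⟧ → A ∈ ⟦ v ⟧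

  -- If `B` did not follow from `w` with `A` added, a prime extension omitting `B` would be a world
  -- above `w` violating the assumption.
  ⇒-∈ : ∀ w {A B} → (∀ v → w ≼ v → A ∈ ⟦ v ⟧ → B ∈ ⟦ v ⟧) → (A ⇒ B) ∈ ⟦ w ⟧
  ⇒-∈ w {A} {B} h with em {⟦ w ⟧ ∪ ｛ A ｝ ⊢ B}
  ... | yes d = closed w (deduction d)
  ... | no  ⊬B with lindenbaum ⊬B
  ...   | v , wA⊆v , B∉v = contradiction (h v (wA⊆v ∘ inj₁) (wA⊆v (inj₂ refl))) B∉v

  mp-∈ : ∀ w {A B} → Base Int (A ⇒ B) → A ∈ ⟦ w ⟧ → B ∈ ⟦ w ⟧
  mp-∈ w a A∈ = closed w (mp (hyp A∈) (axiom a))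

  mp₂-∈ : ∀ w {A B D} → Base Int (A ⇒ B ⇒ D) → A ∈ ⟦ w ⟧ → B ∈ ⟦ w ⟧ → D ∈ ⟦ w ⟧
  mp₂-∈ w a A∈ B∈ = closed w (mp (hyp B∈) (mp (hyp A∈) (axiom a)))

  -- The argument witnesses non-emptiness; a world is available as soon as some formula is
  -- underivable.
  canonicalModel : World → BasicModel CS
  canonicalModel w₀ = record
    { W          = World
    ; inhabitant = w₀
    ; _≤_        = _≼_
    ; isPreorder = record
      { isEquivalence = isEquivalence
      ; reflexive     = λ { refl A∈ → A∈ }
      ; trans         = λ u≼v v≼w A∈ → v≼w (u≼v A∈)
      }
    ; val      = λ p w → χ w (var p)
    ; prf      = λ t w A → ([ t ] A) ∈ ⟦ w ⟧
    ; sat      = λ m w A → (⟨ m ⟩ A) ∈ ⟦ w ⟧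
    ; val-mono = λ _ w≼v → w≼v
    ; prf-mono = λ _ w≼v → w≼v
    ; sat-mono = λ _ w≼v → w≼v
    ; prf-·    = λ { w s t (A , A⇒B∈ , A∈) → mp₂-∈ w (k□ s t A _) A⇒B∈ A∈ }
    ; sat-⋆    = λ { w s m (A , A⇒B∈ , A∈) → mp₂-∈ w (k◇ s m A _) A⇒B∈ A∈ }
    ; prf-+    = λ w s t → Sum.[ mp-∈ w (+₁ s t _) , mp-∈ w (+₂ s t _) ]
    ; sat-⊔    = λ w m n → Sum.[ mp-∈ w (⊔₁ m n _) , mp-∈ w (⊔₂ m n _) ]
    ; prf-can  = λ w _ _ c → closed w (theorem (can c))
    ; sat-∨    = λ w m A B → prime w ∘ mp-∈ w (◇∨ m A B)
    -- The premise of the condition, read at every world above `w`, says that membership of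
    -- `⟨ m ⟩ A` forces that of `[ t ] B`. Hence their implication lies in `w`, and the axiom
    -- applies.
    ; prf-▷    = λ w m t A B h → mp-∈ w (◇□ m t A B) (⇒-∈ w (λ v w≼v ◇A∈ →
                   Sum.[ contradiction ◇A∈ , (λ □B∈ → □B∈) ] (h v w≼v)))
    ; sat-⊥    = λ w m → consistent w ∘ mp-∈ w (◇⊥ m)
    }

  -- The truth lemma.

  module _ (w₀ : World) where
    private 𝓑 = canonicalModel w₀

    -- The two directions are proved together, because each one's implication case uses the other on
    -- the antecedent.
    truth⇒∈ : ∀ A w → 𝓑 , w ⊩ A → A ∈ ⟦ w ⟧
    ∈⇒truth : ∀ A w → A ∈ ⟦ w ⟧ → 𝓑 , w ⊩ A

    truth⇒∈ (var p)   w h        = h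
    truth⇒∈ (A ∧ B)   w (a , b)  =
      closed w (⊢-∧I (hyp (truth⇒∈ A w a)) (hyp (truth⇒∈ B w b)))
    truth⇒∈ (A ∨ B)   w (inj₁ a) = closed w (⊢-∨I₁ (hyp (truth⇒∈ A w a)))
    truth⇒∈ (A ∨ B)   w (inj₂ b) = closed w (⊢-∨I₂ (hyp (truth⇒∈ B w b)))
    truth⇒∈ (A ⇒ B)   w h        =
      ⇒-∈ w (λ v w≼v A∈ → truth⇒∈ B v (h v w≼v (∈⇒truth A v A∈)))
    truth⇒∈ ([ t ] A) w h        = h
    truth⇒∈ (⟨ m ⟩ A) w h        = h

    ∈⇒truth (var p)   w h = h
    ∈⇒truth bot       w h = consistent w h
    ∈⇒truth (A ∧ B)   w h =
      ∈⇒truth A w (closed w (⊢-∧E₁ (hyp h))) , ∈⇒truth B w (closed w (⊢-∧E₂ (hyp h)))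
    ∈⇒truth (A ∨ B)   w h = Sum.map (∈⇒truth A w) (∈⇒truth B w) (prime w h)
    ∈⇒truth (A ⇒ B)   w h v w≼v a =
      ∈⇒truth B v (closed v (mp (hyp (truth⇒∈ A v a)) (hyp (w≼v h))))
    ∈⇒truth ([ t ] A) w h = h
    ∈⇒truth (⟨ m ⟩ A) w h = h

theorem3p6 : ExcludedMiddle 0ℓ →
    (𝓢 : Signature) (Int : IntAxioms) (CS : ConstantSpecification 𝓢 Int) →
    (A : Formula 𝓢) → ⊨b CS A → ⊢JIK CS A
theorem3p6 em 𝓢 Int CS A ⊨A with em {⊢JIK CS A}
... | yes ⊢A = ⊢A
... | no  ⊬A =
  let open Canonical em CS
      -- Extending the empty set gives a world without `A`, which serves both as inhabitant of the
      -- model and as the point refuting `A`.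
      w , _ , A∉w = lindenbaum (⊬A ∘ Derivability.∅⊢⇒⊢JIK CS)
  in contradiction (truth⇒∈ w A w (⊨A (canonicalModel w) w)) A∉w
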